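{- For any graph $D$ (loops allowed) and any integer $q\ge 2$, $$p_0[D,q] \le 1 - q^{ -\tau(D)}.$$
   Context: Graphs are finite and directed: $D=(V,E)$ with $V=\{1,\dots,n\}$, $n\ge1$, $E\subseteq V^2$. A loop $(v,v)$ counts as a cycle of length one; cycles are directed. A feedback vertex set of $D$ is a set $I\subseteq V$ such that $D-I$ has no cycles; $\tau(D)$ is the minimum size of a feedback vertex set. For an integer $q\ge2$ let $[q]=\{0,\dots,q-1\}$. For $f=(f_1,\dots,f_n):[q]^n\to[q]^n$, the interaction graph $G(f)$ has vertex set $V$ and an arc $(u,v)$ if and only if there exist $x,y\in[q]^n$ differing only in coordinate $u$ with $f_v(x)\ne f_v(y)$. $\mathrm{F}[D,q]$ is the set of all $f:[q]^n\to[q]^n$ with $G(f)=D$, and $p_0[D,q]=|\{f\in\mathrm{F}[D,q] : f \text{ has no fixed point}\}|/|\mathrm{F}[D,q]|$. -}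

module Defs where

open import Data.Bool using (Bool; true; false; if_then_else_)
open import Data.Empty using (⊥-elim)
open import Data.Fin using (Fin; zero; suc; _≟_; funToFin; finToFun)
open import Data.Fin.Properties
  using (all?; injective⇒≤; finToFun-funToFin; funToFin-finToFin)
  renaming (any? to anyFin?)
open import Data.Fin.Subset using (Subset; ⊤; _∉_; ∣_∣)
open import Data.Fin.Subset.Properties using (_∈?_; ∈⊤; ∣⊤∣≡n)
open import Data.Integer using (+_)
open import Data.List
  using (List; []; _∷_; _∷ʳ_; [_]; length; map; filter; allFin; cartesianProductWith)
  renaming (lookup to lookupₗ)
open import Data.List.Extrema.Nat using (min; min≤xs; argmin-sel)
open import Data.List.Membership.Propositional using (lose) renaming (_∈_ to _∈ₗ_)
open import Data.List.Membership.Propositional.Properties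
  using (∈-cartesianProductWith⁺; ∈-allFin; ∈-map⁺; ∈-map⁻; ∈-filter⁺; ∈-filter⁻; ∈-lookup)
open import Data.List.Properties using (filter-some)
import Data.List.Relation.Unary.All as All
open import Data.List.Relation.Unary.AllPairs using ([]; _∷_)
open import Data.List.Relation.Unary.Any as Any using (Any; here; there; any?)
import Data.List.Relation.Unary.Any.Properties as Any
open import Data.List.Relation.Unary.Linked using (Linked; _∷_; linked?)
open import Data.List.Relation.Unary.Unique.DecPropositional using (unique?)
open import Data.List.Relation.Unary.Unique.Propositional using (Unique)
import Data.List.Relation.Unary.Unique.Propositional.Properties as Unique
import Data.List.Relation.Unary.Unique.Setoid as SetoidUnique
import Data.List.Relation.Unary.Unique.Setoid.Properties as SetoidUnique
open import Data.Nat using (ℕ; zero; suc; 2+; _≤_; _^_; NonZero; NonTrivial; s≤s⁻¹; >-nonZero)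
open import Data.Nat.Base using (nonTrivial⇒nonZero)
open import Data.Nat.Properties using (m^n≢0)
open import Data.Product using (∃; ∃₂; _×_; _,_; proj₂)
open import Data.Rational using (ℚ; _/_)
open import Data.Sum using (inj₁; inj₂)
open import Data.Vec using (Vec; []; _∷_; lookup; tabulate; replicate; _[_]≔_)
open import Data.Vec.Properties
  using ( lookup∘tabulate; tabulate∘lookup; tabulate-cong; lookup-replicate
        ; lookup∘update; lookup∘update′; ∷-injective; ≡-dec)
open import Function using (_∘_; _⇔_; mk⇔; Equivalence)
open import Level using (0ℓ)
open import Relation.Binary using (Rel; Decidable)
open import Relation.Binary.PropositionalEquality
  using (_≡_; _≢_; _≗_; refl; sym; trans; cong; subst; setoid; _→-setoid_)
open import Relation.Nullary using (¬_; Dec; yes; no; does; contradiction)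
open import Relation.Nullary.Decidable
  using (map′; ¬?; _×-dec_; _→-dec_; does-⇔; dec-true; dec-false)
import Relation.Unary as Pred

private
  variable
    A : Set
    m n q : ℕ

vecs : List A → ∀ n → List (Vec A n)
vecs xs zero    = [ [] ]
vecs xs (suc n) = cartesianProductWith _∷_ xs (vecs xs n)

vecs-complete : ∀ {xs : List A} → (∀ a → a ∈ₗ xs) → (as : Vec A n) → as ∈ₗ vecs xs n
vecs-complete all []       = here refl
vecs-complete all (a ∷ as) = ∈-cartesianProductWith⁺ _∷_ (all a) (vecs-complete all as)

vecs-unique : ∀ {xs : List A} → Unique xs → ∀ n → Unique (vecs xs n)
vecs-unique xs! zero    = All.[] ∷ []
vecs-unique xs! (suc n) = Unique.cartesianProductWith⁺ _∷_ ∷-injective xs! (vecs-unique xs! n)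

searchVec : ∀ {xs : List A} → (∀ a → a ∈ₗ xs) →
            {P : Vec A n → Set} → Pred.Decidable P → Dec (∃ P)
searchVec {n = n} {xs = xs} all P? =
  map′ (λ p → Any.satisfied p) (λ (as , p) → lose (vecs-complete all as) p) (any? P? (vecs xs n))

record Digraph (n : ℕ) : Set₁ where
  field
    Arc  : Rel (Fin n) 0ℓ
    arc? : Decidable Arc

-- A deleted vertex remains in the vertex type but loses all its arcs (its loop
-- included), so it lies on no cycle.
infixl 6 _─_
_─_ : Digraph n → Subset n → Digraph n
D ─ I = record
  { Arc  = λ u v → u ∉ I × v ∉ I × Arc u v
  ; arc? = λ u v → ¬? (u ∈? I) ×-dec ¬? (v ∈? I) ×-dec arc? u v
  } where open Digraph D

-- The cycle v → v₁ → ⋯ → vₖ → v is listed as v ∷ v₁ ∷ ⋯ ∷ vₖ ∷ [], with distinct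
-- entries; a loop at v is the case k = 0.
IsCycle : Digraph n → Fin n → List (Fin n) → Set
IsCycle D v vs = Unique (v ∷ vs) × Linked Arc (v ∷ vs ∷ʳ v)
  where open Digraph D

Acyclic : Digraph n → Set
Acyclic D = ¬ ∃₂ (IsCycle D)

IsFVS : Digraph n → Subset n → Set
IsFVS D I = Acyclic (D ─ I)

lookupₗ-injective : ∀ {vs : List A} → Unique vs → ∀ i j → lookupₗ vs i ≡ lookupₗ vs j → i ≡ j
lookupₗ-injective (_  ∷ _)   zero    zero    _  = refl
lookupₗ-injective (v∉ ∷ _)   zero    (suc j) eq = ⊥-elim (All.lookup v∉ (∈-lookup j) eq)
lookupₗ-injective (v∉ ∷ _)   (suc i) zero    eq = ⊥-elim (All.lookup v∉ (∈-lookup i) (sym eq))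
lookupₗ-injective (_  ∷ vs!) (suc i) (suc j) eq = cong suc (lookupₗ-injective vs! i j eq)

unique⇒length≤ : ∀ {vs : List (Fin n)} → Unique vs → length vs ≤ n
unique⇒length≤ vs! = injective⇒≤ (λ {i} {j} → lookupₗ-injective vs! i j)

searchList : ∀ N {P : List (Fin n) → Set} → Pred.Decidable P →
             (∀ {vs} → P vs → length vs ≤ N) → Dec (∃ P)
searchList zero P? short = map′ ([] ,_)
  (λ { ([] , p) → p ; (_ ∷ _ , p) → contradiction (short p) λ () }) (P? [])
searchList (suc N) P? short with P? []
... | yes p = yes ([] , p)
... | no ¬p = map′ (λ (v , vs , p) → v ∷ vs , p)
                   (λ { ([] , p) → ⊥-elim (¬p p) ; (v ∷ vs , p) → v , vs , p })
                   (anyFin? λ v →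
                     searchList N (P? ∘ (v ∷_)) (λ p → s≤s⁻¹ (short p)))

acyclic? : (D : Digraph n) → Dec (Acyclic D)
acyclic? {n} D = ¬? (anyFin? λ v →
  searchList n (λ vs → unique? _≟_ (v ∷ vs) ×-dec linked? arc? (v ∷ vs ∷ʳ v))
    (λ { (_ ∷ vs! , _) → unique⇒length≤ vs! }))
  where open Digraph D

isFVS? : (D : Digraph n) → Pred.Decidable (IsFVS D)
isFVS? D I = acyclic? (D ─ I)

subsets : ∀ n → List (Subset n)
subsets = vecs (true ∷ false ∷ [])

subsets-complete : (I : Subset n) → I ∈ₗ subsets n
subsets-complete = vecs-complete λ { true → here refl ; false → there (here refl) }

-- The default value n of the minimum is the size of the feedback vertex set V.
τ : Digraph n → ℕ
τ {n} D = min n (map ∣_∣ (filter (isFVS? D) (subsets n)))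

⊤-isFVS : (D : Digraph n) → IsFVS D ⊤
⊤-isFVS D (v , []    , _ , (v∉⊤ , _) ∷ _) = v∉⊤ ∈⊤
⊤-isFVS D (v , _ ∷ _ , _ , (v∉⊤ , _) ∷ _) = v∉⊤ ∈⊤

τ-minimal : (D : Digraph n) (I : Subset n) → IsFVS D I → τ D ≤ ∣ I ∣
τ-minimal {n} D I fvs =
  All.lookup (min≤xs n _) (∈-map⁺ ∣_∣ (∈-filter⁺ (isFVS? D) (subsets-complete I) fvs))

τ-attained : (D : Digraph n) → ∃ λ I → IsFVS D I × ∣ I ∣ ≡ τ D
τ-attained {n} D with argmin-sel (λ k → k) n (map ∣_∣ (filter (isFVS? D) (subsets n)))
... | inj₁ τ≡n = ⊤ , ⊤-isFVS D , trans (∣⊤∣≡n n) (sym τ≡n)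
... | inj₂ τ∈ with ∈-map⁻ ∣_∣ τ∈
...   | I , I∈ , τ≡ = I , proj₂ (∈-filter⁻ (isFVS? D) {xs = subsets n} I∈) , sym τ≡

State : ℕ → ℕ → Set
State q n = Vec (Fin q) n

Map : ℕ → ℕ → Set
Map q n = State q n → State q n

states : ∀ q n → List (State q n)
states q n = vecs (allFin q) n

searchState : {P : State q n → Set} → Pred.Decidable P → Dec (∃ P)
searchState = searchVec ∈-allFin

-- x and y agree off coordinate u; since f x and f y differ, they do differ at u.
Influences : Map q n → Rel (Fin n) 0ℓ
Influences f u v = ∃₂ λ x y →
  (∀ w → w ≢ u → lookup x w ≡ lookup y w) × lookup (f x) v ≢ lookup (f y) v

influences? : (f : Map q n) → Decidable (Influences f)
influences? f u v = searchState λ x → searchState λ y →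
  all? (λ w → ¬? (w ≟ u) →-dec (lookup x w ≟ lookup y w))
  ×-dec ¬? (lookup (f x) v ≟ lookup (f y) v)

-- G(f) = D
HasInteractionGraph : Digraph n → Map q n → Set
HasInteractionGraph D f = ∀ u v → Influences f u v ⇔ Arc u v
  where open Digraph D

hasInteractionGraph? : (D : Digraph n) → Pred.Decidable (HasInteractionGraph {q = q} D)
hasInteractionGraph? D f = all? λ u → all? λ v →
  map′ (λ (to , from) → mk⇔ to from) (λ e → Equivalence.to e , Equivalence.from e)
    ((influences? f u v →-dec arc? u v) ×-dec (arc? u v →-dec influences? f u v))
  where open Digraph D

HasFixedPoint : Map q n → Set
HasFixedPoint f = ∃ λ x → f x ≡ x

hasFixedPoint? : Pred.Decidable (HasFixedPoint {q} {n})
hasFixedPoint? f = searchState λ x → ≡-dec _≟_ (f x) x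

-- A map is represented by the table of its qⁿ values, so that `maps q n` lists every
-- map exactly once up to pointwise equality (see maps-complete and maps-unique) and
-- the lengths of its filtered sublists are cardinalities.
encode : State q n → Fin (q ^ n)
encode x = funToFin (lookup x)

decode : Fin (q ^ n) → State q n
decode i = tabulate (finToFun i)

fromTable : Vec (State q n) (q ^ n) → Map q n
fromTable t x = lookup t (encode x)

maps : ∀ q n → List (Map q n)
maps q n = map fromTable (vecs (states q n) (q ^ n))

funToFin-cong : {f g : Fin m → Fin n} → f ≗ g → funToFin f ≡ funToFin g
funToFin-cong {zero}  f≗g = refl
funToFin-cong {suc m} f≗g
  rewrite f≗g zero | funToFin-cong (λ i → f≗g (suc i)) = refl

decode-encode : (x : State q n) → decode (encode x) ≡ x
decode-encode x = trans (tabulate-cong (finToFun-funToFin (lookup x))) (tabulate∘lookup x)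

encode-decode : (i : Fin (q ^ n)) → encode {q} {n} (decode i) ≡ i
encode-decode {q} {n} i = trans
  (funToFin-cong {n} {q} (lookup∘tabulate (finToFun i)))
  (funToFin-finToFin {n} {q} i)

maps-complete : (f : Map q n) → Any (f ≗_) (maps q n)
maps-complete {q} {n} f = Any.map⁺ (lose (vecs-complete (vecs-complete ∈-allFin) table) f≗)
  where
  table : Vec (State q n) (q ^ n)
  table = tabulate (f ∘ decode)

  f≗ : f ≗ fromTable table
  f≗ x = sym (trans (lookup∘tabulate (f ∘ decode) (encode x)) (cong f (decode-encode x)))

fromTable-injective : {s t : Vec (State q n) (q ^ n)} → fromTable s ≗ fromTable t → s ≡ t
fromTable-injective {q} {n} {s} {t} s≗t = trans (sym (tabulate∘lookup s)) (trans
  (tabulate-cong λ i → subst (λ j → lookup s j ≡ lookup t j) (encode-decode {q} {n} i) (s≗t (decode i)))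
  (tabulate∘lookup t))

maps-unique : ∀ q n → SetoidUnique.Unique (State q n →-setoid State q n) (maps q n)
maps-unique q n = SetoidUnique.map⁺ (setoid _) (State q n →-setoid State q n) fromTable-injective
  (vecs-unique (vecs-unique (Unique.allFin⁺ q) n) (q ^ n))

F[_,_] : Digraph n → ∀ q → List (Map q n)
F[_,_] {n} D q = filter (hasInteractionGraph? D) (maps q n)

HasInteractionGraph-resp : (D : Digraph n) {f g : Map q n} → f ≗ g →
                           HasInteractionGraph D f → HasInteractionGraph D g
HasInteractionGraph-resp D {f} {g} f≗g G u v = mk⇔
  (λ (x , y , x~y , g≢) → Equivalence.to (G u v) (x , y , x~y , λ eq → g≢
     (trans (sym (at x)) (trans eq (at y)))))
  (λ a → let (x , y , x~y , f≢) = Equivalence.from (G u v) a in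
     x , y , x~y , λ eq → f≢ (trans (at x) (trans eq (sym (at y)))))
  where
  at : ∀ x → lookup (f x) v ≡ lookup (g x) v
  at x = cong (λ s → lookup s v) (f≗g x)

-- F[D,q] is nonempty: fᵥ(x) = 0 if x vanishes on all in-neighbours of v, else 1.
module Witness (D : Digraph n) (m : ℕ) where
  open Digraph D

  Vanishes : State (2+ m) n → Fin n → Set
  Vanishes x v = ∀ u → Arc u v → lookup x u ≡ zero

  vanishes? : ∀ x v → Dec (Vanishes x v)
  vanishes? x v = all? λ u → arc? u v →-dec (lookup x u ≟ zero)

  bit : Bool → Fin (2+ m)
  bit b = if b then zero else suc zero

  or : Map (2+ m) n
  or x = tabulate λ v → bit (does (vanishes? x v))

  lookup-or : ∀ x v → lookup (or x) v ≡ bit (does (vanishes? x v))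
  lookup-or x v = lookup∘tabulate _ v

  or-graph : HasInteractionGraph D or
  or-graph u v = mk⇔ to from
    where
    to : Influences or u v → Arc u v
    to (x , y , x~y , or≢) with arc? u v
    ... | yes a = a
    ... | no ¬a = ⊥-elim (or≢ (trans (lookup-or x v) (trans
          (cong bit (does-⇔ x⇔y (vanishes? x v) (vanishes? y v))) (sym (lookup-or y v)))))
      where
      agree : ∀ w → Arc w v → lookup x w ≡ lookup y w
      agree w a = x~y w λ { refl → ¬a a }

      x⇔y : Vanishes x v ⇔ Vanishes y v
      x⇔y = mk⇔ (λ z w a → trans (sym (agree w a)) (z w a)) (λ z w a → trans (agree w a) (z w a))

    from : Arc u v → Influences or u v
    from a = x , y , (λ w w≢u → sym (lookup∘update′ w≢u x (suc zero))) , or≢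
      where
      x y : State (2+ m) n
      x = replicate n zero
      y = x [ u ]≔ suc zero

      x-vanishes : Vanishes x v
      x-vanishes w _ = lookup-replicate w zero

      y-does-not : ¬ Vanishes y v
      y-does-not z with trans (sym (z u a)) (lookup∘update u x (suc zero))
      ... | ()

      or≢ : lookup (or x) v ≢ lookup (or y) v
      or≢ eq with trans (sym (trans (lookup-or x v) (cong bit (dec-true (vanishes? x v) x-vanishes))))
                   (trans eq (trans (lookup-or y v) (cong bit (dec-false (vanishes? y v) y-does-not))))
      ... | ()

F-nonempty : (D : Digraph n) (q : ℕ) .{{_ : NonTrivial q}} → NonZero (length F[ D , q ])
F-nonempty D (2+ m) = >-nonZero (filter-some (hasInteractionGraph? D)
  (Any.map (λ or≗g → HasInteractionGraph-resp D or≗g or-graph) (maps-complete or)))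
  where open Witness D m

p₀[_,_] : Digraph n → (q : ℕ) .{{_ : NonTrivial q}} → ℚ
p₀[ D , q ] = (+ length (filter (¬? ∘ hasFixedPoint?) F[ D , q ])) / length F[ D , q ]
  where instance _ = F-nonempty D q

infixr 8 _^-_
_^-_ : (q t : ℕ) .{{_ : NonTrivial q}} → ℚ
q ^- t = (+ 1) / (q ^ t)
  where instance _ = m^n≢0 q t {{nonTrivial⇒nonZero q}}

{-# OPTIONS --safe #-}

-- Let I be a minimum feedback vertex set of D. Since D − I is acyclic, every f with
-- G(f) = D has a state x with xᵥ = 0 for v ∈ I and fᵥ(x) = xᵥ for v ∉ I. Composing each
-- fᵥ, v ∈ I, with the transposition of 0 and cᵥ := fᵥ(x) leaves the interaction graph
-- unchanged and makes x a fixed point, and f is recovered from the new map together with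
-- c. As c is supported on I, |F[D,q]| is at most q^τ(D) times the number of maps in
-- F[D,q] that have a fixed point.
module Submission where

open import Defs
open import Data.Bool using (true; false)
open import Data.Fin using (Fin; zero; suc; _≟_)
open import Data.Fin.Permutation.Components using (transpose; transpose-inverse)
open import Data.Fin.Properties using (injective⇒≤)
open import Data.Fin.Subset using (Subset; _∈_; _∉_; ∣_∣)
open import Data.Fin.Subset.Properties using (_∈?_)
open import Data.Integer as ℤ using (+_; +≤+)
import Data.Integer.Properties as ℤ
open import Data.List
  using (List; []; _∷_; _∷ʳ_; [_]; _++_; length; map; filter; allFin; cartesianProductWith)
  renaming (lookup to lookupₗ)
import Data.List.Membership.DecPropositional as DecMembership
import Data.List.Membership.Propositional as Membership
open import Data.List.Membership.Propositional.Properties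
  using (∈-cartesianProductWith⁺; ∈-allFin; ∈-map⁺; ∈-∃++; ∈-lookup)
import Data.List.Membership.Setoid as SetoidMembership
import Data.List.Membership.Setoid.Properties as Membershipₚ
open import Data.List.Properties using (length-map; length-tabulate; length-++)
open import Data.List.Relation.Unary.All as All using (All; []; _∷_)
import Data.List.Relation.Unary.All.Properties as All
open import Data.List.Relation.Unary.AllPairs using ([]; _∷_)
open import Data.List.Relation.Unary.Any using (here)
open import Data.List.Relation.Unary.Linked using (Linked; [-]; _∷_)
open import Data.List.Relation.Unary.Unique.Propositional using (Unique)
import Data.List.Relation.Unary.Unique.Setoid as SetoidUnique
import Data.List.Relation.Unary.Unique.Setoid.Properties as Uniqueₚ
open import Data.Nat using (ℕ; zero; suc; 2+; _+_; _*_; _^_; NonZero; NonTrivial)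
  renaming (_≤_ to _≤ℕ_)
open import Data.Nat.Properties
  using ( +-suc; +-comm; +-identityʳ; *-comm; *-distribˡ-+; +-monoʳ-≤; +-cancelʳ-≤
        ; ≤-trans; ≤-reflexive; 1+n≰n; m^n≢0; module ≤-Reasoning )
open import Data.Product using (∃; ∃₂; _×_; _,_; proj₁; proj₂)
open import Data.Rational using (_≤_; _-_; -_; 1ℚ; _/_; toℚᵘ)
import Data.Rational.Properties as ℚ
import Data.Rational.Unnormalised as ℚᵘ
import Data.Rational.Unnormalised.Properties as ℚᵘ
open import Data.Vec using (Vec; []; _∷_; lookup; tabulate; replicate; there)
open import Data.Vec.Properties using (lookup∘tabulate; tabulate∘lookup; tabulate-cong; lookup-replicate)
open import Function using (_∘_; mk⇔; Equivalence)
open import Level using (0ℓ)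
open import Relation.Binary using (Setoid; DecidableEquality)
open import Relation.Binary.PropositionalEquality
  using (_≡_; _≢_; _≗_; refl; sym; trans; cong; cong₂; subst₂; setoid; _→-setoid_)
open import Relation.Nullary using (¬_; yes; no; contradiction)
open import Relation.Nullary.Decidable using (¬?; dec-true; decidable-stable)
import Relation.Unary as Pred

private
  variable
    A B C : Set
    m n q : ℕ

-- Counting

module _ (S : Setoid 0ℓ 0ℓ) where
  open Setoid S using (_≈_) renaming (sym to ≈-sym)
  open SetoidUnique S using () renaming (Unique to Uniqueₛ)
  open SetoidMembership S using () renaming (_∈_ to _∈ₛ_)

  lookup-injective : ∀ {xs} → Uniqueₛ xs → ∀ i j → lookupₗ xs i ≈ lookupₗ xs j → i ≡ j
  lookup-injective (_  ∷ _)   zero    zero    _  = refl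
  lookup-injective (x∉ ∷ _)   zero    (suc j) eq = contradiction eq (All.lookup x∉ (∈-lookup j))
  lookup-injective (x∉ ∷ _)   (suc i) zero    eq = contradiction (≈-sym eq) (All.lookup x∉ (∈-lookup i))
  lookup-injective (_  ∷ xs!) (suc i) (suc j) eq = cong suc (lookup-injective xs! i j eq)

  -- Sending each position of `xs` to the position of an equal entry of `ys` is injective, because
  -- `xs` has no repetitions. A general setoid allows maps to be compared pointwise.
  unique-⊆⇒length≤ : ∀ {xs ys} → Uniqueₛ xs → (∀ {x} → x ∈ₛ xs → x ∈ₛ ys) → length xs ≤ℕ length ys
  unique-⊆⇒length≤ {xs} xs! xs⊆ys = injective⇒≤ λ {i} {j} eq →
    lookup-injective xs! i j (Membershipₚ.index-injective S (member i) (member j) eq)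
    where
    member = λ i → xs⊆ys (Membershipₚ.∈-lookup S xs i)

length-cartesianProductWith : (f : A → B → C) (xs : List A) (ys : List B) →
                              length (cartesianProductWith f xs ys) ≡ length xs * length ys
length-cartesianProductWith f []       ys = refl
length-cartesianProductWith f (x ∷ xs) ys = trans
  (length-++ (map (f x) ys))
  (cong₂ _+_ (length-map (f x) ys) (length-cartesianProductWith f xs ys))

length-filter-¬? : {P : A → Set} (P? : Pred.Decidable P) (xs : List A) →
                   length (filter (¬? ∘ P?) xs) + length (filter P? xs) ≡ length xs
length-filter-¬? P? []       = refl
length-filter-¬? P? (x ∷ xs) with P? x
... | yes _ = trans (+-suc _ _) (cong suc (length-filter-¬? P? xs))
... | no  _ = cong suc (length-filter-¬? P? xs)

-- Paths and cycles

unique-++⁻ˡ : ∀ (xs : List A) {ys} → Unique (xs ++ ys) → Unique xs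
unique-++⁻ˡ []       _          = []
unique-++⁻ˡ (x ∷ xs) (x∉ ∷ xs!) = All.++⁻ˡ xs x∉ ∷ unique-++⁻ˡ xs xs!

unique⇒∉-prefix : ∀ (xs : List A) {x ys} → Unique (xs ++ x ∷ ys) → All (x ≢_) xs
unique⇒∉-prefix []       _          = []
unique⇒∉-prefix (y ∷ xs) (y∉ ∷ xs!) =
  All.head (All.++⁻ʳ xs y∉) ∘ sym ∷ unique⇒∉-prefix xs xs!

linked-prefix : ∀ {R : A → A → Set} xs {x ys} → Linked R (xs ++ x ∷ ys) → Linked R (xs ∷ʳ x)
linked-prefix []           _       = [-]
linked-prefix (_ ∷ [])     (r ∷ _) = r ∷ [-]
linked-prefix (_ ∷ y ∷ xs) (r ∷ l) = r ∷ linked-prefix (y ∷ xs) l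

module _ (D : Digraph n) where
  open Digraph D
  open Membership using () renaming (_∈_ to _∈ₗ_)
  open DecMembership (_≟_ {n}) using () renaming (_∈?_ to _∈ₗ?_)

  -- The stretch of the path from `v` up to the occurrence of `u` is closed by the arc from `u` to
  -- `v`.
  close-cycle : ∀ {u v vs} → Unique (v ∷ vs) → Linked Arc (v ∷ vs) → Arc u v →
                u ∈ₗ v ∷ vs → ∃ (IsCycle D u)
  close-cycle {u} vs! l a u∈ with ∈-∃++ u∈
  -- Here `u` is `v` itself, so the arc is a loop.
  ... | []     , zs , refl = [] , [] ∷ [] , a ∷ [-]
  ... | y ∷ ys , zs , refl =
    y ∷ ys , unique⇒∉-prefix (y ∷ ys) vs! ∷ unique-++⁻ˡ (y ∷ ys) vs! , a ∷ linked-prefix (y ∷ ys) l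

  -- Backward tracing of a property through arcs, one level down per step, would give a
  -- path with more than n vertices.
  acyclic⇒no-descent : Acyclic D → (P : ℕ → Fin n → Set) →
                       (∀ k {v} → P (suc k) v → ∃ λ u → Arc u v × P k u) → ∀ v → ¬ P n v
  acyclic⇒no-descent acyclic P back v p =
    extend n ([] ∷ []) [-] p (≤-reflexive (+-comm 1 n))
    where
    extend : ∀ k {v vs} → Unique (v ∷ vs) → Linked Arc (v ∷ vs) → P k v →
             ¬ (suc n ≤ℕ k + length (v ∷ vs))
    extend zero    vs! l p long = 1+n≰n (≤-trans long (unique⇒length≤ vs!))
    extend (suc k) {v} {vs} vs! l p long with back k p
    ... | u , a , p′ with u ∈ₗ? v ∷ vs
    ...   | yes u∈ = acyclic (u , close-cycle vs! l a u∈)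
    ...   | no  u∉ = extend k (All.¬Any⇒All¬ _ u∉ ∷ vs!) (a ∷ l) p′
                       (≤-trans long (≤-reflexive (sym (+-suc k _))))

-- Fixed points off a feedback vertex set

lookup-extensional : {x y : Vec A n} → (∀ v → lookup x v ≡ lookup y v) → x ≡ y
lookup-extensional {x = x} {y} eq =
  trans (sym (tabulate∘lookup x)) (trans (tabulate-cong eq) (tabulate∘lookup y))

module _ (_≟ᴮ_ : DecidableEquality B) where

  -- Passing from x to y one coordinate at a time, g changes at some step.
  sensitive-coordinate : (g : Vec A n → B) (x y : Vec A n) → g x ≢ g y →
    ∃ λ u → lookup x u ≢ lookup y u ×
      ∃₂ λ z w → (∀ t → t ≢ u → lookup z t ≡ lookup w t) × g z ≢ g w
  sensitive-coordinate g []       []       g≢ = contradiction refl g≢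
  sensitive-coordinate g (a ∷ xs) (b ∷ ys) g≢ with g (a ∷ xs) ≟ᴮ g (b ∷ xs)
  ... | no  d = zero , (λ a≡b → d (cong (g ∘ (_∷ xs)) a≡b)) , a ∷ xs , b ∷ xs ,
                (λ { zero t≢ → contradiction refl t≢ ; (suc t) _ → refl }) , d
  ... | yes e with sensitive-coordinate (g ∘ (b ∷_)) xs ys (g≢ ∘ trans e)
  ...   | u , ≢ , z , w , z~w , d = suc u , ≢ , b ∷ z , b ∷ w ,
          (λ { zero _ → refl ; (suc t) t≢ → z~w t (t≢ ∘ cong suc) }) , d

-- Iterate `f` from the zero state, resetting the coordinates in `I` to zero after each step. A
-- coordinate that changes at one step has an in-neighbour outside `I` that changed at the step
-- before. As `D ─ I` is acyclic, nothing changes after `n` steps, and the state `orbit n` is the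
-- one sought.
fixed-off-FVS : (D : Digraph n) (I : Subset n) → IsFVS D I →
                (f : Map (suc m) n) → HasInteractionGraph D f →
                ∃ λ x → ∀ v → (v ∈ I → lookup x v ≡ zero) × (v ∉ I → lookup (f x) v ≡ lookup x v)
fixed-off-FVS {n} {m} D I fvs f G = x , λ v → zero-on n v , fixed v
  where
  open Digraph D

  clamp : Fin n → Fin (suc m) → Fin (suc m)
  clamp v a with v ∈? I
  ... | yes _ = zero
  ... | no  _ = a

  clamp-∈ : ∀ {v a} → v ∈ I → clamp v a ≡ zero
  clamp-∈ {v} v∈ with v ∈? I
  ... | yes _  = refl
  ... | no  v∉ = contradiction v∈ v∉

  clamp-∉ : ∀ {v a} → v ∉ I → clamp v a ≡ a
  clamp-∉ {v} v∉ with v ∈? I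
  ... | yes v∈ = contradiction v∈ v∉
  ... | no  _  = refl

  orbit : ℕ → State (suc m) n
  orbit zero    = replicate n zero
  orbit (suc k) = tabulate λ v → clamp v (lookup (f (orbit k)) v)

  lookup-orbit : ∀ k v → lookup (orbit (suc k)) v ≡ clamp v (lookup (f (orbit k)) v)
  lookup-orbit k v = lookup∘tabulate _ v

  zero-on : ∀ k v → v ∈ I → lookup (orbit k) v ≡ zero
  zero-on zero    v v∈ = lookup-replicate v zero
  zero-on (suc k) v v∈ = trans (lookup-orbit k v) (clamp-∈ v∈)

  Changes : ℕ → Fin n → Set
  Changes k v = lookup (orbit (suc k)) v ≢ lookup (orbit k) v

  changes⇒∉ : ∀ k {v} → Changes k v → v ∉ I
  changes⇒∉ k {v} c v∈ = c (trans (zero-on (suc k) v v∈) (sym (zero-on k v v∈)))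

  -- An arc is witnessed by states that differ in one coordinate only, while consecutive states of
  -- the orbit may differ in many; `sensitive-coordinate` bridges the gap. The coordinate `u` it
  -- finds has just changed, so it lies outside `I`, where alone changes occur.
  back : ∀ k {v} → Changes (suc k) v → ∃ λ u → (u ∉ I × v ∉ I × Arc u v) × Changes k u
  back k {v} c
    with sensitive-coordinate _≟_ (λ y → lookup (f y) v) (orbit (suc k)) (orbit k)
           (λ eq → c (trans (lookup-orbit (suc k) v) (trans (cong (clamp v) eq) (sym (lookup-orbit k v)))))
  ... | u , ≢ , infl =
    u , (changes⇒∉ k ≢ , changes⇒∉ (suc k) c , Equivalence.to (G u v) infl) , ≢

  x : State (suc m) n
  x = orbit n

  fixed : ∀ v → v ∉ I → lookup (f x) v ≡ lookup x v
  -- Off `I` clamping does nothing, so stability of `orbit n` at `v` is the fixed point equation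
  -- there.
  fixed v v∉ = trans (sym (clamp-∉ v∉)) (trans (sym (lookup-orbit n v))
    (decidable-stable (_ ≟ _) (acyclic⇒no-descent (D ─ I) fvs Changes back v)))

-- Transposing values

transpose-same : (i j : Fin n) → transpose i i j ≡ j
transpose-same i j with j ≟ i
... | yes eq = sym eq
... | no  ne with j ≟ i
...   | yes eq = contradiction eq ne
...   | no  _  = refl

transpose-target : (i j : Fin n) → transpose i j j ≡ i
transpose-target i j with j ≟ i
... | yes eq = eq
... | no  _ rewrite dec-true (j ≟ j) refl = refl

transpose-injective : (i j : Fin n) {k l : Fin n} → transpose i j k ≡ transpose i j l → k ≡ l
transpose-injective i j eq =
  trans (sym (transpose-inverse j i)) (trans (cong (transpose j i) eq) (transpose-inverse j i))

-- Both ends of the transpositions are arguments, so that the inverse is the same operation with `a`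
-- and `b` exchanged.
relabel : (a b : State q n) → Map q n → Map q n
relabel a b f x = tabulate λ v → transpose (lookup a v) (lookup b v) (lookup (f x) v)

lookup-relabel : (a b : State q n) (f : Map q n) (x : State q n) (v : Fin n) →
  lookup (relabel a b f x) v ≡ transpose (lookup a v) (lookup b v) (lookup (f x) v)
lookup-relabel a b f x v = lookup∘tabulate _ v

relabel-cong : (a b : State q n) {f g : Map q n} → f ≗ g → relabel a b f ≗ relabel a b g
relabel-cong a b f≗g x =
  tabulate-cong λ v → cong (transpose (lookup a v) (lookup b v) ∘ (λ y → lookup y v)) (f≗g x)

relabel-inverse : (a b : State q n) (f : Map q n) → f ≗ relabel a b (relabel b a f)
relabel-inverse a b f x = lookup-extensional λ v → sym (trans (lookup-relabel a b (relabel b a f) x v)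
  (trans (cong (transpose (lookup a v) (lookup b v)) (lookup-relabel b a f x v))
    (transpose-inverse (lookup a v) (lookup b v))))

-- The values of each coordinate pass through an injection, so the same pairs of states witness an
-- influence before and after.
relabel-graph : (D : Digraph n) (a b : State q n) {f : Map q n} →
                HasInteractionGraph D f → HasInteractionGraph D (relabel a b f)
relabel-graph D a b {f} G u v = mk⇔
  (λ (x , y , x~y , r≢) → Equivalence.to (G u v) (x , y , x~y , λ eq → r≢
     (trans (at x) (trans (cong (transpose (lookup a v) (lookup b v)) eq) (sym (at y))))))
  (λ arc → let (x , y , x~y , f≢) = Equivalence.from (G u v) arc in
     x , y , x~y , λ eq → f≢ (transpose-injective (lookup a v) (lookup b v)
       (trans (sym (at x)) (trans eq (at y)))))
  where
  at = λ x → lookup-relabel a b f x v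

-- Covering F[D,q] by relabelled maps that have a fixed point

supported : ∀ m → Subset n → List (State (suc m) n)
supported m []          = [ [] ]
supported m (true  ∷ I) = cartesianProductWith _∷_ (allFin (suc m)) (supported m I)
supported m (false ∷ I) = map (zero ∷_) (supported m I)

length-supported : (I : Subset n) → length (supported m I) ≡ suc m ^ ∣ I ∣
length-supported         []          = refl
length-supported {m = m} (true  ∷ I) = trans
  (length-cartesianProductWith _∷_ (allFin (suc m)) (supported m I))
  (cong₂ _*_ (length-tabulate {n = suc m} (λ i → i)) (length-supported I))
length-supported {m = m} (false ∷ I) = trans (length-map (zero ∷_) (supported m I)) (length-supported I)

∈-supported : (I : Subset n) (c : State (suc m) n) → (∀ v → v ∉ I → lookup c v ≡ zero) →
              c Membership.∈ supported m I
∈-supported []          []      _ = here refl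
∈-supported (true  ∷ I) (a ∷ c) z = ∈-cartesianProductWith⁺ _∷_ (∈-allFin a)
  (∈-supported I c λ v v∉ → z (suc v) λ { (there v∈) → v∉ v∈ })
∈-supported (false ∷ I) (a ∷ c) z with z zero (λ ())
... | refl = ∈-map⁺ (zero ∷_) (∈-supported I c λ v v∉ → z (suc v) λ { (there v∈) → v∉ v∈ })

-- Let `x` be the state from `fixed-off-FVS`. On `I`, transposing zero with the value of `f x` turns
-- that value into zero, the entry of `x`. Off `I`, `c` is zero, the transposition is trivial, and
-- `x` is already fixed.
relabel-to-fixed : (D : Digraph n) (I : Subset n) → IsFVS D I →
                   (f : Map (suc m) n) → HasInteractionGraph D f →
                   ∃ λ c → c Membership.∈ supported m I ×
                           HasFixedPoint (relabel (replicate n zero) c f)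
relabel-to-fixed {n} {m} D I fvs f G with fixed-off-FVS D I fvs f G
... | x , x-spec = c , ∈-supported I c c-∉ , x , lookup-extensional fixed
  where
  value : Fin n → Fin (suc m)
  value v with v ∈? I
  ... | yes _ = lookup (f x) v
  ... | no  _ = zero

  c : State (suc m) n
  c = tabulate value

  c-∈ : ∀ v → v ∈ I → lookup c v ≡ lookup (f x) v
  c-∈ v v∈ rewrite lookup∘tabulate value v with v ∈? I
  ... | yes _  = refl
  ... | no  v∉ = contradiction v∈ v∉

  c-∉ : ∀ v → v ∉ I → lookup c v ≡ zero
  c-∉ v v∉ rewrite lookup∘tabulate value v with v ∈? I
  ... | yes v∈ = contradiction v∈ v∉
  ... | no  _  = refl

  relabelled : ∀ {v a} → lookup c v ≡ a →
               lookup (relabel (replicate n zero) c f x) v ≡ transpose zero a (lookup (f x) v)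
  relabelled {v} c≡a = trans (lookup-relabel (replicate n zero) c f x v)
    (cong₂ (λ z a → transpose z a (lookup (f x) v)) (lookup-replicate v zero) c≡a)

  fixed : ∀ v → lookup (relabel (replicate n zero) c f x) v ≡ lookup x v
  fixed v with v ∈? I
  ... | yes v∈ = trans (relabelled (c-∈ v v∈))
                   (trans (transpose-target zero (lookup (f x) v)) (sym (proj₁ (x-spec v) v∈)))
  ... | no  v∉ = trans (relabelled (c-∉ v v∉))
                   (trans (transpose-same zero (lookup (f x) v)) (proj₂ (x-spec v) v∉))

HasFixedPoint-resp : {f g : Map q n} → f ≗ g → HasFixedPoint f → HasFixedPoint g
HasFixedPoint-resp f≗g (x , fx≡x) = x , trans (sym (f≗g x)) fx≡x

-- It suffices that every `f` is restored from some pair of a supported `c` and a map with a fixed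
-- point. Repetitions in the list of restored maps only make it longer.
F≤q^τ*fixed : (D : Digraph n) (m : ℕ) →
  length F[ D , suc m ] ≤ℕ suc m ^ τ D * length (filter hasFixedPoint? F[ D , suc m ])
F≤q^τ*fixed {n} D m with τ-attained D
... | I , fvs , ∣I∣≡τ = begin
  length F                                        ≤⟨ unique-⊆⇒length≤ S F! covered ⟩
  length (cartesianProductWith restore cs Fix)    ≡⟨ length-cartesianProductWith restore cs Fix ⟩
  length cs * length Fix                          ≡⟨ cong (_* length Fix) (length-supported I) ⟩
  suc m ^ ∣ I ∣ * length Fix                      ≡⟨ cong (λ t → suc m ^ t * length Fix) ∣I∣≡τ ⟩
  suc m ^ τ D * length Fix                        ∎
  where
  open ≤-Reasoning
  S = State (suc m) n →-setoid State (suc m) n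
  open SetoidMembership S using () renaming (_∈_ to _∈ₛ_)

  F   = F[ D , suc m ]
  Fix = filter hasFixedPoint? F
  cs  = supported m I
  0⃗   = replicate n zero

  restore : State (suc m) n → Map (suc m) n → Map (suc m) n
  restore c = relabel c 0⃗

  F! : SetoidUnique.Unique S F
  F! = Uniqueₚ.filter⁺ S (hasInteractionGraph? D) (maps-unique (suc m) n)

  ∈F : ∀ {g} → HasInteractionGraph D g → g ∈ₛ F
  ∈F {g} = Membershipₚ.∈-filter⁺ S (hasInteractionGraph? D) (HasInteractionGraph-resp D) (maps-complete g)

  restore-preserves : ∀ {c c′ : State (suc m) n} {g g′} → c ≡ c′ → g ≗ g′ → restore c g ≗ restore c′ g′
  restore-preserves {c} refl = relabel-cong c 0⃗

  covered : ∀ {f} → f ∈ₛ F → f ∈ₛ cartesianProductWith restore cs Fix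
  covered {f} f∈ =
    let _ , G       = Membershipₚ.∈-filter⁻ S (hasInteractionGraph? D) (HasInteractionGraph-resp D)
                        {xs = maps (suc m) n} f∈
        c , c∈ , fp = relabel-to-fixed D I fvs f G
        g∈          = Membershipₚ.∈-filter⁺ S hasFixedPoint? HasFixedPoint-resp
                        (∈F (relabel-graph D 0⃗ c {f} G)) fp
    -- Relabelling `f` and restoring it gives `f` back only up to pointwise equality, which is the
    -- equality of `S`.
    in Membershipₚ.∈-resp-≈ S {x = restore c (relabel 0⃗ c f)} {f} (λ x → sym (relabel-inverse c 0⃗ f x))
         (Membershipₚ.∈-cartesianProductWith⁺ (setoid _) S S restore-preserves c∈ g∈)

-- Rational arithmetic

-- The hypothesis is the conclusion cleared of denominators. Passing to unnormalised rationals
-- avoids the reduction to lowest terms, so the comparison is one of cross products.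
/≤1-1/ : ∀ a b d .{{_ : NonZero b}} .{{_ : NonZero d}} → d * a + b ≤ℕ d * b →
         (+ a) / b ≤ 1ℚ - (+ 1) / d
/≤1-1/ a b@(suc b-1) d@(suc d-1) le = ℚ.toℚᵘ-cancel-≤ (begin
  toℚᵘ ((+ a) / b)              ≃⟨ ℚ.toℚᵘ-fromℚᵘ (ℚᵘ.mkℚᵘ (+ a) b-1) ⟩
  (+ a) ℚᵘ./ b                  ≤⟨ ℚᵘ.*≤* cross-ℤ ⟩
  ℚᵘ.1ℚᵘ ℚᵘ.- (+ 1) ℚᵘ./ d      ≃⟨ ℚᵘ.+-congʳ ℚᵘ.1ℚᵘ (ℚᵘ.-‿cong (ℚ.toℚᵘ-fromℚᵘ (ℚᵘ.mkℚᵘ (+ 1) d-1))) ⟨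
  ℚᵘ.1ℚᵘ ℚᵘ.- toℚᵘ ((+ 1) / d)  ≃⟨ ℚᵘ.+-congʳ ℚᵘ.1ℚᵘ (ℚ.toℚᵘ-homo‿- ((+ 1) / d)) ⟨
  ℚᵘ.1ℚᵘ ℚᵘ.+ toℚᵘ (- ((+ 1) / d)) ≃⟨ ℚ.toℚᵘ-homo-+ 1ℚ (- ((+ 1) / d)) ⟨
  toℚᵘ (1ℚ - (+ 1) / d)         ∎)
  where
  open ℚᵘ.≤-Reasoning

  -- The terms `d-1 + 0` are what multiplication by one leaves in the numerator and denominator of
  -- the unnormalised difference.
  cross : a * suc (d-1 + 0) ≤ℕ (d-1 + 0) * b
  cross rewrite +-identityʳ d-1 | *-comm a d =
    +-cancelʳ-≤ b (d * a) (d-1 * b) (≤-trans le (≤-reflexive (+-comm b (d-1 * b))))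

  -- The two sides are the cross products of a/b and of the computed difference 1 − 1/d.
  cross-ℤ : + a ℤ.* + suc (d-1 + 0) ℤ.≤ + (d-1 + 0) ℤ.* + b
  cross-ℤ = subst₂ ℤ._≤_ (ℤ.pos-* a (suc (d-1 + 0))) (ℤ.pos-* (d-1 + 0) b) (+≤+ cross)

proposition4p3 : (n : ℕ) .{{_ : NonZero n}} (D : Digraph n) (q : ℕ) .{{_ : NonTrivial q}} → p₀[ D , q ] ≤ 1ℚ - (q ^- τ D)
proposition4p3 n D q@(2+ m) =
  -- The lower bound on `fix` becomes an upper bound on `noFix`, as the two add up to `F`.
  /≤1-1/ noFix F Q {{F-nonempty D q}} {{m^n≢0 q (τ D)}} (begin
    Q * noFix + F        ≤⟨ +-monoʳ-≤ (Q * noFix) (F≤q^τ*fixed D (suc m)) ⟩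
    Q * noFix + Q * fix  ≡⟨ *-distribˡ-+ Q noFix fix ⟨
    Q * (noFix + fix)    ≡⟨ cong (Q *_) (length-filter-¬? hasFixedPoint? F[ D , q ]) ⟩
    Q * F                ∎)
  where
  open ≤-Reasoning
  Q     = q ^ τ D
  F     = length F[ D , q ]
  fix   = length (filter hasFixedPoint? F[ D , q ])
  noFix = length (filter (¬? ∘ hasFixedPoint?) F[ D , q ])
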